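{- Let $G=(V,E)$ be a simple undirected graph. The graphical neighbotope $\Gamma_G$ is the polymatroid base polytope for the polymatroid $$f(S)=|S|+|\mathrm{Nb}_G(S)|,$$ where $\mathrm{Nb}_G(S)=\{u\in V\setminus S : uv\in E\text{ for some }v\in S\}$ for $S\subseteq V$. In particular, $\Gamma_G=B_f$.
   Context: For $v\in V$, $\mathrm{Nb}_G(v)$ is the set of nodes adjacent to $v$. A branching on $G$ is a map $\mathcal{B}:V\to V$ such that $\mathcal{B}(v)\in\mathrm{Nb}_G(v)\cup\{v\}$ for all $v$ and for every $v\in V$ there is $k\geq0$ with $\mathcal{B}^k(v)=\mathcal{B}^{k+1}(v)$. Its reduced in-degree sequence is $\bar\delta(\mathcal{B})\in\mathbb{R}^V$ with $\bar\delta(\mathcal{B})_v=|\mathcal{B}^{ -1}(v)|-1$. The graphical neighbotope is $\Gamma_G=\operatorname{conv}\{\bar\delta(\mathcal{B}) : \mathcal{B}\text{ a branching of }G\}\subset\mathbb{R}^V$. A set function $f:2^V\to\mathbb{Z}_{\geq0}$ is a polymatroid if $f(\emptyset)=0$, $f(A)\le f(B)$ for $A\subseteq B$, and $f(A\cup B)+f(A\cap B)\leq f(A)+f(B)$ for all $A,B\subseteq V$. With $x(A)=\sum_{v\in A}x_v$, the polymatroid polytope is $P_f=\{x\in\mathbb{R}^V_{\geq0} : x(A)\leq f(A)\text{ for all }A\subseteq V\}$ and the polymatroid base polytope is $B_f=P_f\cap\{x : x(V)=f(V)\}$.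
   Formalization: With reduced in-degrees, points of Γ_G have coordinate sum 0 while those of B_f have sum |V|, so Γ_G = B_f fails for nonempty V; what is proved is that Γ_G translated by the all-ones vector equals B_f, over any ordered field with decidable order. -}

module Defs where

open import Level using (Level; 0ℓ; _⊔_; suc)
open import Algebra.Bundles using (CommutativeRing)
import Algebra.Definitions.RawMonoid as RawMonoidDefs
open import Data.Bool.Base using (if_then_else_)
open import Data.Fin.Base using (Fin)
open import Data.Fin.Properties using (_≟_; any?)
open import Data.Fin.Subset using (Subset; ∣_∣; _∈_; _⊆_; _∪_; _∩_; ⊥; ⊤)
open import Data.Fin.Subset.Properties using (_∈?_)
import Data.Nat.Base as ℕ
open import Data.Nat.Base using (ℕ)
open import Data.Nat.GeneralisedArithmetic using (iterate)
open import Data.Product.Base using (∃-syntax; _×_)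
open import Data.Sum.Base using (_⊎_)
open import Data.Vec.Base using (tabulate)
open import Data.Vec.Functional using (Vector)
open import Function.Base using (_∘_)
open import Relation.Binary.Core using (Rel)
import Relation.Binary.Definitions as Binary
open import Relation.Binary.PropositionalEquality.Core using (_≡_)
open import Relation.Binary.Structures using (IsDecTotalOrder)
open import Relation.Nullary.Decidable using (does; ¬?; _×-dec_)
open import Relation.Nullary.Negation using (¬_)
open import Relation.Unary using (Pred; Decidable)

private
  variable
    c ℓ₁ ℓ₂ ℓ : Level
    n : ℕ

-- The library has neither real numbers nor ordered fields.  Polytopes are
-- therefore taken in Kⱽ for an arbitrary ordered field K; classically ℝ is one,
-- its order being decidable by excluded middle.

record OrderedField (c ℓ₁ ℓ₂ : Level) : Set (suc (c ⊔ ℓ₁ ⊔ ℓ₂)) where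
  infix 4 _≤_
  field
    commutativeRing : CommutativeRing c ℓ₁
  open CommutativeRing commutativeRing public
  field
    _≤_             : Rel Carrier ℓ₂
    isDecTotalOrder : IsDecTotalOrder _≈_ _≤_
    0≉1             : ¬ (0# ≈ 1#)
    inverse         : ∀ x → ¬ (x ≈ 0#) → ∃[ y ] (x * y ≈ 1#)
    +-monoˡ-≤       : ∀ z {x y} → x ≤ y → (x + z) ≤ (y + z)
    *-nonNeg        : ∀ {x y} → 0# ≤ x → 0# ≤ y → 0# ≤ (x * y)

  open RawMonoidDefs +-rawMonoid public using (sum)

  fromℕ : ℕ → Carrier
  fromℕ k = RawMonoidDefs._×_ +-rawMonoid k 1#

record SimpleGraph (n : ℕ) : Set₁ where
  infix 4 _~_ _~?_
  field
    _~_      : Rel (Fin n) 0ℓ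
    ~-sym    : Binary.Symmetric _~_
    ~-irrefl : Binary.Irreflexive _≡_ _~_
    _~?_     : Binary.Decidable _~_

subset : {P : Pred (Fin n) ℓ} → Decidable P → Subset n
subset P? = tabulate (does ∘ P?)

module _ (G : SimpleGraph n) where
  open SimpleGraph G

  Nb : Subset n → Subset n
  Nb S = subset λ u → ¬? (u ∈? S) ×-dec any? λ v → (v ∈? S) ×-dec (u ~? v)

  nbFunction : Subset n → ℕ
  nbFunction S = ∣ S ∣ ℕ.+ ∣ Nb S ∣

  record IsBranching (β : Fin n → Fin n) : Set where
    field
      local      : ∀ v → (v ~ β v) ⊎ (β v ≡ v)
      stabilises : ∀ v → ∃[ k ] (iterate β v k ≡ iterate β v (ℕ.suc k))

inDegree : (Fin n → Fin n) → Fin n → ℕ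
inDegree β v = ∣ subset (λ u → β u ≟ v) ∣

record IsPolymatroid (f : Subset n → ℕ) : Set where
  field
    normalised  : f ⊥ ≡ 0
    monotone    : ∀ A B → A ⊆ B → f A ℕ.≤ f B
    submodular  : ∀ A B → f (A ∪ B) ℕ.+ f (A ∩ B) ℕ.≤ f A ℕ.+ f B

module _ (K : OrderedField c ℓ₁ ℓ₂) where
  open OrderedField K

  Point : ℕ → Set c
  Point n = Vector Carrier n

  record Conv (P : Pred (Point n) ℓ) (x : Point n) : Set (c ⊔ ℓ₁ ⊔ ℓ₂ ⊔ ℓ) where
    field
      size          : ℕ
      point         : Fin size → Point n
      weight        : Fin size → Carrier
      point∈P       : ∀ i → P (point i)
      weight-nonNeg : ∀ i → 0# ≤ weight i
      weight-sum    : sum weight ≈ 1#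
      combination   : ∀ v → x v ≈ sum (λ i → weight i * point i v)

  reducedInDegree : (Fin n → Fin n) → Point n
  reducedInDegree β v = fromℕ (inDegree β v) - 1#

  neighbotope : SimpleGraph n → Pred (Point n) (c ⊔ ℓ₁ ⊔ ℓ₂)
  neighbotope G = Conv λ p →
    ∃[ β ] (IsBranching G β × (∀ v → p v ≈ reducedInDegree β v))

  total : Point n → Subset n → Carrier
  total x A = sum (λ v → if does (v ∈? A) then x v else 0#)

  polymatroidPolytope : (Subset n → ℕ) → Pred (Point n) ℓ₂
  polymatroidPolytope f x = (∀ v → 0# ≤ x v) × (∀ A → total x A ≤ fromℕ (f A))

  basePolytope : (Subset n → ℕ) → Pred (Point n) (ℓ₁ ⊔ ℓ₂)
  basePolytope f x = polymatroidPolytope f x × (total x ⊤ ≈ fromℕ (f ⊤))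

  𝟙 : Point n
  𝟙 _ = 1#

  -- The Minkowski sum P + {t}.  It is needed to compare the neighbotope with a
  -- base polytope: reduced in-degrees sum to 0, whereas the points of
  -- basePolytope (nbFunction G) have coordinate sum n.  The translate by 𝟙
  -- undoes the "- 1" in reducedInDegree.
  translate : Point n → Pred (Point n) ℓ → Pred (Point n) (c ⊔ ℓ₁ ⊔ ℓ)
  translate t P x = ∃[ y ] (P y × (∀ v → x v ≈ y v + t v))

{-# OPTIONS --safe #-}

-- nbFunction G is the coverage function S ↦ #{u : N[u] ∩ S ≠ ∅} of the closed
-- neighbourhoods N[u], which makes it a polymatroid and its base polytope the
-- Minkowski sum of the simplices Δ(N[u]).  For the nontrivial inclusion the
-- simplices are split off one at a time, and each is treated one vertex at a
-- time: an uncrossing argument leaves room for a suitable coordinate.  The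
-- Minkowski sum is the convex hull of the in-degree vectors of all maps β with
-- β u ∈ N[u], and turning the cycles of such a map into fixed points gives a
-- branching with the same in-degrees.

module Submission where

open import Defs
open import Level using (Level; _⊔_)
open import Data.Bool.Base using (Bool; true; false; not; _∧_; _∨_; if_then_else_)
open import Data.Bool.ListAction using (any)
open import Data.Fin.Base using (Fin; zero; suc; toℕ; funToFin; finToFun; _↑ˡ_; _↑ʳ_; remQuot; combine)
open import Data.Fin.Permutation using (Permutation; permutation; _⟨$⟩ʳ_)
import Data.Fin.Properties as Fin
open import Data.Fin.Subset using (Subset; ∣_∣; _∪_; _∩_; _⊆_; ⊥; ⊤; inside; outside)
open import Data.Fin.Subset.Properties using (_∈?_; ∣p∣≤n; ∣⊤∣≡n; p∩q⊆p; p∩q⊆q)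
open import Data.List.Base as List using (List; []; _∷_; length; filter; allFin)
open import Data.List.Membership.Propositional using (_∈_)
open import Data.List.Membership.Propositional.Properties
  using (∈-lookup; ∈-filter⁺; ∈-filter⁻; ∈-allFin)
open import Data.List.Relation.Unary.Any using (here; there)
import Data.Nat.Base as ℕ
open import Data.Nat.Base using (ℕ; zero; suc)
open import Data.Nat.GeneralisedArithmetic using (iterate)
import Data.Nat.Properties as ℕ
open import Data.Product.Base using (Σ-syntax; ∃-syntax; _×_; _,_; proj₁; proj₂; uncurry)
open import Data.Sum.Base using (_⊎_; inj₁; inj₂)
open import Data.Vec.Base as Vec using ([]; _∷_; lookup; _[_]≔_; here; there)
open import Data.Vec.Functional as Vector using (Vector)
open import Data.Vec.Properties
  using (tabulate∘lookup; lookup-zipWith; lookup-replicate; []=⇒lookup; lookup⇒[]=; lookup∘update)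
open import Function.Base using (_∘_; case_of_)
open import Relation.Binary.Bundles using (Poset)
open import Relation.Binary.PropositionalEquality as ≡ using (_≡_)
open import Relation.Binary.Structures using (IsDecTotalOrder)
open import Relation.Nullary.Decidable using (does; yes; no; _×-dec_)
open import Relation.Nullary.Negation using (¬_; contradiction)
open import Relation.Unary using (Pred; Decidable; _≐_)

-- Reading each `u` as a source with one unit of supply deliverable within N[u], and `x` as a demand
-- vector, the inequality x(A) <= #{u : N[u] meets A} is Hall's condition. The nontrivial inclusion
-- is thus a fractional transport theorem. Its invariant is x(A) <= f(A) + c [A meets N]: `f` covers
-- the sources still to come, `c` is what is left of the current supply, and `N` lists the vertices
-- it has not yet been offered to. The amount delivered at each vertex is a maximum over finitely
-- many sets, so it exists in every ordered field. During the recursion supply may be left over;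
-- only the coordinate sum, equal to the number of sources, rules out waste. Unwinding keeps
-- in-degrees because each vertex of a cycle trades its one incoming cycle arc for a loop.

private
  variable
    ℓ ℓ′ ℓ″ : Level
    m n : ℕ

module _ where
  open import Algebra.Properties.CommutativeSemigroup ℕ.+-commutativeSemigroup
    using (interchange)
  open import Data.Nat.Base using (_+_; _*_; _^_; _≤_; z≤n; s≤s)
  open ≡ using (refl; sym; trans; cong; cong₂; subst; subst₂; module ≡-Reasoning)

  -- Cardinalities compared bit by bit.

  bit : Bool → ℕ
  bit true  = 1
  bit false = 0

  -- This form agrees definitionally with the size of a `subset`, so that `Nb` and `inDegree` are
  -- instances.
  count : (Fin m → Bool) → ℕ
  count b = ∣ Vec.tabulate b ∣

  count-suc : (b : Fin (suc m) → Bool) → count b ≡ bit (b zero) + count (b ∘ suc)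
  count-suc b with b zero
  ... | true  = refl
  ... | false = refl

  count-cong : {a b : Fin m → Bool} → (∀ u → a u ≡ b u) → count a ≡ count b
  count-cong {zero}  a≗b = refl
  count-cong {suc m} {a} {b} a≗b = begin
    count a                          ≡⟨ count-suc a ⟩
    bit (a zero) + count (a ∘ suc)   ≡⟨ cong₂ (λ x y → bit x + y) (a≗b zero) (count-cong (a≗b ∘ suc)) ⟩
    bit (b zero) + count (b ∘ suc)   ≡⟨ count-suc b ⟨
    count b                          ∎
    where open ≡-Reasoning

  count-mono : {a b : Fin m → Bool} → (∀ u → bit (a u) ≤ bit (b u)) → count a ≤ count b
  count-mono {zero}  a≤b = z≤n
  count-mono {suc m} {a} {b} a≤b = begin
    count a                          ≡⟨ count-suc a ⟩
    bit (a zero) + count (a ∘ suc)   ≤⟨ ℕ.+-mono-≤ (a≤b zero) (count-mono (a≤b ∘ suc)) ⟩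
    bit (b zero) + count (b ∘ suc)   ≡⟨ count-suc b ⟨
    count b                          ∎
    where open ℕ.≤-Reasoning

  count-+-suc : (a b : Fin (suc m) → Bool) →
    count a + count b ≡
      (bit (a zero) + bit (b zero)) + (count (a ∘ suc) + count (b ∘ suc))
  count-+-suc a b = begin
    count a + count b
      ≡⟨ cong₂ _+_ (count-suc a) (count-suc b) ⟩
    (bit (a zero) + count (a ∘ suc)) + (bit (b zero) + count (b ∘ suc))
      ≡⟨ interchange (bit (a zero)) _ _ _ ⟩
    (bit (a zero) + bit (b zero)) + (count (a ∘ suc) + count (b ∘ suc)) ∎
    where open ≡-Reasoning

  count-sum-mono : {a b c d : Fin m → Bool} →
    (∀ u → bit (a u) + bit (b u) ≤ bit (c u) + bit (d u)) →
    count a + count b ≤ count c + count d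
  count-sum-mono {zero}  ab≤cd = z≤n
  count-sum-mono {suc m} {a} {b} {c} {d} ab≤cd
    rewrite count-+-suc a b | count-+-suc c d =
    ℕ.+-mono-≤ (ab≤cd zero) (count-sum-mono (ab≤cd ∘ suc))

  count-disjoint : {a b c : Fin m → Bool} →
    (∀ u → bit (a u) + bit (b u) ≡ bit (c u)) → count a + count b ≡ count c
  count-disjoint {zero}  ab≡c = refl
  count-disjoint {suc m} {a} {b} {c} ab≡c = begin
    count a + count b                ≡⟨ count-+-suc a b ⟩
    (bit (a zero) + bit (b zero)) + (count (a ∘ suc) + count (b ∘ suc))
                                     ≡⟨ cong₂ _+_ (ab≡c zero) (count-disjoint (ab≡c ∘ suc)) ⟩
    bit (c zero) + count (c ∘ suc)   ≡⟨ count-suc c ⟨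
    count c                          ∎
    where open ≡-Reasoning

  count-false : ∀ m → count {m} (λ _ → false) ≡ 0
  count-false zero    = refl
  count-false (suc m) = count-false m

  count≤ : (b : Fin m → Bool) → count b ≤ m
  count≤ b = ∣p∣≤n (Vec.tabulate b)

  -- Lists meeting sets, and coverage functions.

  lookup-mono : {A B : Subset n} → A ⊆ B → ∀ v → lookup A v ≡ true → lookup B v ≡ true
  lookup-mono {A = A} A⊆B v v∈A = []=⇒lookup (A⊆B (lookup⇒[]= v A v∈A))

  does-∈? : (v : Fin n) (A : Subset n) → does (v ∈? A) ≡ lookup A v
  does-∈? zero    (inside  ∷ A) = refl
  does-∈? zero    (outside ∷ A) = refl
  does-∈? (suc v) (_       ∷ A) = does-∈? v A

  -- As a fold, `hits (v ∷ N) A` computes to `lookup A v ∨ hits N A`, the case split on which `peel`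
  -- runs.
  hits : List (Fin n) → Subset n → Bool
  hits N A = any (lookup A) N

  hits-∈ : {N : List (Fin n)} (A : Subset n) {v : Fin n} →
    v ∈ N → lookup A v ≡ true → hits N A ≡ true
  hits-∈ {N = w ∷ N} A (here refl) v∈A rewrite v∈A = refl
  hits-∈ {N = w ∷ N} A (there v∈N) v∈A with lookup A w
  ... | true  = refl
  ... | false = hits-∈ A v∈N v∈A

  hits-mono : (N : List (Fin n)) {A B : Subset n} → A ⊆ B →
    hits N A ≡ true → hits N B ≡ true
  hits-mono (v ∷ N) {A} {B} A⊆B hit with lookup A v in v∈A | lookup B v in v∈B
  ... | _     | true  = refl
  ... | true  | false = contradiction (trans (sym v∈B) (lookup-mono A⊆B v v∈A)) λ ()
  ... | false | false = hits-mono N A⊆B hit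

  hits-∪ : (N : List (Fin n)) (A B : Subset n) → hits N (A ∪ B) ≡ hits N A ∨ hits N B
  hits-∪ []      A B = refl
  hits-∪ (v ∷ N) A B rewrite lookup-zipWith _∨_ v A B | hits-∪ N A B
    with lookup A v | lookup B v | hits N A
  ... | true  | _     | _     = refl
  ... | false | true  | true  = refl
  ... | false | true  | false = refl
  ... | false | false | _     = refl

  hits-⊥ : (N : List (Fin n)) → hits N ⊥ ≡ false
  hits-⊥ []      = refl
  hits-⊥ (v ∷ N) rewrite lookup-replicate v outside = hits-⊥ N

  hits-antimono : (N : List (Fin n)) {A B : Subset n} → A ⊆ B →
    hits N B ≡ false → hits N A ≡ false
  hits-antimono N {A} A⊆B miss with hits N A in hit
  ... | true  = trans (sym (hits-mono N A⊆B hit)) miss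
  ... | false = refl

  remove-⊆ : (A : Subset n) (v : Fin n) → (A [ v ]≔ outside) ⊆ A
  remove-⊆ (_ ∷ A) zero    (there u∈A)   = there u∈A
  remove-⊆ (_ ∷ A) (suc v) here          = here
  remove-⊆ (_ ∷ A) (suc v) (there u∈A-v) = there (remove-⊆ A v u∈A-v)

  coverage : (Fin m → List (Fin n)) → Subset n → ℕ
  coverage N A = count (λ u → hits (N u) A)

  bit-mono : {a b : Bool} → (a ≡ true → b ≡ true) → bit a ≤ bit b
  bit-mono {false} a⇒b = z≤n
  bit-mono {true}  a⇒b rewrite a⇒b refl = s≤s z≤n

  -- Here `c` stands for meeting the intersection. It implies `a` and `b` but may fail when both
  -- hold, since a list can meet two sets in different vertices; this is where coverage is
  -- submodular and not modular.
  bit-submodular : {a b c : Bool} → (c ≡ true → a ≡ true) → (c ≡ true → b ≡ true) →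
    bit (a ∨ b) + bit c ≤ bit a + bit b
  bit-submodular {true}  {b} {c} c⇒a c⇒b = s≤s (bit-mono c⇒b)
  bit-submodular {false} {b} {false} c⇒a c⇒b = ℕ.≤-reflexive (ℕ.+-identityʳ (bit b))
  bit-submodular {false} {b} {true} c⇒a c⇒b = contradiction (c⇒a refl) λ ()

  coverage-isPolymatroid : (N : Fin m → List (Fin n)) → IsPolymatroid (coverage N)
  coverage-isPolymatroid {m} N = record
    { normalised = trans (count-cong (hits-⊥ ∘ N)) (count-false m)
    ; monotone   = λ A B A⊆B → count-mono λ u → bit-mono (hits-mono (N u) {A} {B} A⊆B)
    ; submodular = λ A B → count-sum-mono λ u →
        subst (λ h → bit h + bit (hits (N u) (A ∩ B)) ≤ bit (hits (N u) A) + bit (hits (N u) B))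
          (sym (hits-∪ (N u) A B))
          (bit-submodular (hits-mono (N u) {A ∩ B} {A} (p∩q⊆p A B))
                          (hits-mono (N u) {A ∩ B} {B} (p∩q⊆q A B)))
    }

  IsPolymatroid-resp : {f g : Subset n → ℕ} → (∀ A → f A ≡ g A) →
    IsPolymatroid f → IsPolymatroid g
  IsPolymatroid-resp f≗g f-poly = record
    { normalised = trans (sym (f≗g ⊥)) normalised
    ; monotone   = λ A B A⊆B → subst₂ _≤_ (f≗g A) (f≗g B) (monotone A B A⊆B)
    ; submodular = λ A B → subst₂ _≤_ (cong₂ _+_ (f≗g _) (f≗g _))
                                      (cong₂ _+_ (f≗g _) (f≗g _)) (submodular A B)
    }
    where open IsPolymatroid f-poly

  -- Identifies a search through the list `closedNb` with the decision procedure inside `Nb`.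
  -- `allFin` is the case where `f` is the identity; a general `f` lets the induction pass to
  -- `f ∘ suc`.
  any-filter-tabulate : ∀ {a q r} {A : Set a} {Q : Pred A q} {R : Pred (Fin m) r}
    (p : A → Bool) (Q? : Decidable Q) (R? : Decidable R) (f : Fin m → A) →
    (∀ i → does (R? i) ≡ p (f i) ∧ does (Q? (f i))) →
    any p (filter Q? (List.tabulate f)) ≡ does (Fin.any? R?)
  any-filter-tabulate {zero}  p Q? R? f R≗ = refl
  any-filter-tabulate {suc m} p Q? R? f R≗
    rewrite R≗ zero with p (f zero) in pf | does (Q? (f zero))
  ... | true  | true  rewrite pf = refl
  ... | false | true  rewrite pf = any-filter-tabulate p Q? (R? ∘ suc) (f ∘ suc) (R≗ ∘ suc)
  ... | true  | false = any-filter-tabulate p Q? (R? ∘ suc) (f ∘ suc) (R≗ ∘ suc)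
  ... | false | false = any-filter-tabulate p Q? (R? ∘ suc) (f ∘ suc) (R≗ ∘ suc)

  -- The neighbourhood function as a coverage function.

  module _ (G : SimpleGraph n) where
    open SimpleGraph G

    closedNb : Fin n → List (Fin n)
    closedNb u = u ∷ filter (u ~?_) (allFin n)

    ∈-closedNb⁺ : ∀ {u v} → (u ~ v) ⊎ (v ≡ u) → v ∈ closedNb u
    ∈-closedNb⁺ (inj₁ u~v) = there (∈-filter⁺ (_ ~?_) (∈-allFin _) u~v)
    ∈-closedNb⁺ (inj₂ v≡u) = here v≡u

    ∈-closedNb⁻ : ∀ {u v} → v ∈ closedNb u → (u ~ v) ⊎ (v ≡ u)
    ∈-closedNb⁻ (here v≡u)  = inj₂ v≡u
    ∈-closedNb⁻ (there v∈N) = inj₁ (proj₂ (∈-filter⁻ (_ ~?_) {xs = allFin n} v∈N))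

    -- The vertices whose closed neighbourhood meets `S` split into those in `S` and those outside
    -- `S` with a neighbour in `S`. In bits this is a + (not a and b) = (a or b).
    nbFunction≡coverage : ∀ S → nbFunction G S ≡ coverage closedNb S
    nbFunction≡coverage S = trans
      (cong (λ T → ∣ T ∣ + ∣ Nb G S ∣) (sym (tabulate∘lookup S)))
      (count-disjoint λ u →
        trans (cong (λ a → bit (lookup S u) + bit (not a ∧ does (adjacent? u))) (does-∈? u S))
          (trans (bit-∨ (lookup S u) (does (adjacent? u)))
            (cong (λ b → bit (lookup S u ∨ b))
              (sym (any-filter-tabulate (lookup S) (u ~?_) (adjacent-via? u) (λ v → v)
                (λ v → cong (_∧ does (u ~? v)) (does-∈? v S)))))))
      where
      adjacent-via? = λ u v → (v ∈? S) ×-dec (u ~? v)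
      adjacent? = λ u → Fin.any? (adjacent-via? u)
      bit-∨ : ∀ a b → bit a + bit (not a ∧ b) ≡ bit (a ∨ b)
      bit-∨ true  b = refl
      bit-∨ false b = refl

  -- Iterates of a map, and replacing its cycles by fixed points.

  module _ {a} {A : Set a} (f : A → A) where

    iterate-+ : ∀ x i j → iterate f x (i + j) ≡ iterate f (iterate f x i) j
    iterate-+ x zero    j = refl
    iterate-+ x (suc i) j = iterate-+ (f x) i j

    iterate-suc : ∀ x i → iterate f x (suc i) ≡ f (iterate f x i)
    iterate-suc x zero    = refl
    iterate-suc x (suc i) = iterate-suc (f x) i

    iterate-*-periodic : ∀ {x} p → iterate f x p ≡ x → ∀ k → iterate f x (k * p) ≡ x
    iterate-*-periodic p fᵖx≡x zero    = refl
    iterate-*-periodic {x} p fᵖx≡x (suc k) = begin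
      iterate f x (p + k * p)             ≡⟨ iterate-+ x p (k * p) ⟩
      iterate f (iterate f x p) (k * p)   ≡⟨ cong (λ y → iterate f y (k * p)) fᵖx≡x ⟩
      iterate f x (k * p)                 ≡⟨ iterate-*-periodic p fᵖx≡x k ⟩
      x                                   ∎
      where open ≡-Reasoning

  -- The powers of β are encoded as elements of Fin (n ^ n), where two must collide.
  collision : (β : Fin n → Fin n) →
    ∃[ i ] ∃[ p ] (∀ v → iterate β v i ≡ iterate β v (i + suc p))
  collision {n} β
    with Fin.pigeonhole (ℕ.n<1+n (n ^ n)) (λ k → funToFin (λ v → iterate β v (toℕ k)))
  ... | i , j , i<j , same with ℕ.m≤n⇒∃[o]m+o≡n i<j
  ...   | p , 1+i+p≡j = toℕ i , p , λ v → begin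
    iterate β v (toℕ i)           ≡⟨ Fin.finToFun-funToFin (λ v → iterate β v (toℕ i)) v ⟨
    _                             ≡⟨ cong (λ k → finToFun k v) same ⟩
    _                             ≡⟨ Fin.finToFun-funToFin (λ v → iterate β v (toℕ j)) v ⟩
    iterate β v (toℕ j)           ≡⟨ cong (iterate β v) (sym (trans (ℕ.+-suc (toℕ i) p) 1+i+p≡j)) ⟩
    iterate β v (toℕ i + suc p)   ∎
    where open ≡-Reasoning

  -- A power is idempotent once its exponent is a multiple of the eventual period and at least the
  -- preperiod. The form `suc k` keeps the exponent positive, so that its fixed points really lie on
  -- cycles.
  idempotentPower : (β : Fin n → Fin n) →
    ∃[ k ] (∀ v → iterate β (iterate β v (suc k)) (suc k) ≡ iterate β v (suc k))
  idempotentPower β with collision β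
  ... | i , p , same with ℕ.m≤n⇒∃[o]m+o≡n (ℕ.≤-trans (ℕ.n≤1+n i) (ℕ.m≤m*n (suc i) (suc p)))
  -- The exponent `suc k` is `suc i * suc p`: a multiple of the period `suc p`, and at least the
  -- preperiod `i`.
  ...   | o , i+o≡k = p + i * suc p , λ v →
    iterate-*-periodic β (suc p) (begin
      iterate β (iterate β v (suc i * suc p)) (suc p)
        ≡⟨ iterate-+ β v (suc i * suc p) (suc p) ⟨
      iterate β v (suc i * suc p + suc p)
        ≡⟨ cong (iterate β v) (shift i o (suc p) i+o≡k) ⟩
      iterate β v (i + suc p + o)
        ≡⟨ iterate-+ β v (i + suc p) o ⟩
      iterate β (iterate β v (i + suc p)) o
        ≡⟨ cong (λ w → iterate β w o) (same v) ⟨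
      iterate β (iterate β v i) o
        ≡⟨ iterate-+ β v i o ⟨
      iterate β v (i + o)
        ≡⟨ cong (iterate β v) i+o≡k ⟩
      iterate β v (suc i * suc p) ∎) (suc i)
    where
    open ≡-Reasoning
    shift : ∀ i o q {k} → i + o ≡ k → k + q ≡ i + q + o
    shift i o q refl = trans (ℕ.+-assoc i o q)
      (trans (cong (i +_) (ℕ.+-comm o q)) (sym (ℕ.+-assoc i q o)))

  -- Replacing every cycle of β by fixed points permutes the arguments of β, so
  -- it preserves in-degrees.
  module Unwind (β : Fin n → Fin n) (k : ℕ)
    (idempotent : ∀ v → iterate β (iterate β v (suc k)) (suc k) ≡ iterate β v (suc k))
    where

    -- These are exactly the vertices on cycles of `β`: by idempotence, the fixed points of this
    -- power form its image. One equality test thus decides whether a vertex lies on a cycle.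
    Cyclic : Fin n → Set
    Cyclic v = iterate β v (suc k) ≡ v

    cyclic? : Decidable Cyclic
    cyclic? v = iterate β v (suc k) Fin.≟ v

    cyclic-β : ∀ {v} → Cyclic v → Cyclic (β v)
    cyclic-β {v} cyc = trans (iterate-suc β v (suc k)) (cong β cyc)

    cyclic-iterate : ∀ {v} → Cyclic v → ∀ j → Cyclic (iterate β v j)
    cyclic-iterate cyc zero    = cyc
    cyclic-iterate cyc (suc j) = cyclic-iterate (cyclic-β cyc) j

    unwind : Fin n → Fin n
    unwind v with cyclic? v
    ... | yes _ = v
    ... | no  _ = β v

    private
      -- On cyclic vertices the power `suc k` of `β` is the identity, so the power `k` inverts `β`
      -- there.
      predecessor : Fin n → Fin n
      predecessor v with cyclic? v
      ... | yes _ = iterate β v k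
      ... | no  _ = v

      successor : Fin n → Fin n
      successor v with cyclic? v
      ... | yes _ = β v
      ... | no  _ = v

      predecessor-successor : ∀ v → predecessor (successor v) ≡ v
      predecessor-successor v with cyclic? v
      ... | yes cyc with cyclic? (β v)
      ...   | yes _    = cyc
      ...   | no  ¬cyc = contradiction (cyclic-β cyc) ¬cyc
      predecessor-successor v | no ¬cyc with cyclic? v
      ...   | yes cyc = contradiction cyc ¬cyc
      ...   | no  _   = refl

      successor-predecessor : ∀ v → successor (predecessor v) ≡ v
      successor-predecessor v with cyclic? v
      ... | yes cyc with cyclic? (iterate β v k)
      ...   | yes _    = trans (sym (iterate-suc β v k)) cyc
      ...   | no  ¬cyc = contradiction (cyclic-iterate cyc k) ¬cyc
      successor-predecessor v | no ¬cyc with cyclic? v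
      ...   | yes cyc = contradiction cyc ¬cyc
      ...   | no  _   = refl

    rotation : Permutation n n
    rotation = permutation predecessor successor predecessor-successor successor-predecessor

    unwind≗β∘rotation : ∀ v → unwind v ≡ β (rotation ⟨$⟩ʳ v)
    unwind≗β∘rotation v with cyclic? v
    ... | yes cyc = trans (sym cyc) (iterate-suc β v k)
    ... | no  _   = refl

    unwind-cyclic : ∀ {v} → Cyclic v → unwind v ≡ v
    unwind-cyclic {v} cyc with cyclic? v
    ... | yes _    = refl
    ... | no  ¬cyc = contradiction cyc ¬cyc

    unwind-acyclic : ∀ {v} → ¬ Cyclic v → unwind v ≡ β v
    unwind-acyclic {v} ¬cyc with cyclic? v
    ... | yes cyc = contradiction cyc ¬cyc
    ... | no  _   = refl

    -- Off the cycles `unwind` follows `β`, and the first cyclic vertex on the path is a fixed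
    -- point. The number `j` bounds the steps to a cyclic vertex and drives the recursion.
    stabilises-at-cyclic : ∀ j v → Cyclic (iterate β v j) →
      ∃[ i ] (iterate unwind v i ≡ iterate unwind v (suc i))
    stabilises-at-cyclic zero    v cyc = 0 , sym (unwind-cyclic cyc)
    stabilises-at-cyclic (suc j) v cyc = case cyclic? v of λ where
      (yes here-cyc) → 0 , sym (unwind-cyclic here-cyc)
      (no ¬cyc) → let i , stops = stabilises-at-cyclic j (β v) cyc in
        suc i , subst (λ w → iterate unwind w i ≡ iterate unwind w (suc i))
                      (sym (unwind-acyclic ¬cyc)) stops

    unwind-isBranching : (G : SimpleGraph n) → let open SimpleGraph G in
      (∀ v → (v ~ β v) ⊎ (β v ≡ v)) → IsBranching G unwind
    unwind-isBranching G β-local = record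
      { local      = local
      ; stabilises = λ v → stabilises-at-cyclic (suc k) v (idempotent v)
      }
      where
      open SimpleGraph G
      local : ∀ v → (v ~ unwind v) ⊎ (unwind v ≡ v)
      local v with cyclic? v
      ... | yes _ = inj₂ refl
      ... | no  _ = β-local v

  -- Abstract, since unfolding the exponent found by pigeonhole slows type checking down.
  abstract
    unwinding : (G : SimpleGraph n) (β : Fin n → Fin n) → let open SimpleGraph G in
      (∀ v → (v ~ β v) ⊎ (β v ≡ v)) →
      ∃[ β′ ] ∃[ π ] (IsBranching G β′ × (∀ v → β′ v ≡ β (π ⟨$⟩ʳ v)))
    unwinding G β β-local = let k , idempotent = idempotentPower β; open Unwind β k idempotent in
      unwind , rotation , unwind-isBranching G β-local , unwind≗β∘rotation

module _ {k ℓ₁ ℓ₂} (K : OrderedField k ℓ₁ ℓ₂) where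
  open OrderedField K hiding (sum; zero)
  open IsDecTotalOrder isDecTotalOrder using (isPartialOrder; antisym)
    renaming (total to ≤-total; refl to ≤-refl; reflexive to ≤-reflexive; trans to ≤-trans)

  private
    poset : Poset k ℓ₁ ℓ₂
    poset = record { isPartialOrder = isPartialOrder }

  open import Algebra.Properties.Semiring.Sum semiring
  open import Algebra.Properties.Monoid.Mult +-monoid using (×-homo-+; ×-congˡ)
  open import Algebra.Properties.Ring ring using (-1*x≈-x; -‿involutive)
  open import Algebra.Solver.CommutativeMonoid +-commutativeMonoid
    using (solve; _⊕_; _⊜_)
  open import Relation.Binary.Reasoning.PartialOrder poset

  -- Inequalities and finite sums in an ordered field.

  +-mono-≤ : ∀ {a b x y} → a ≤ b → x ≤ y → a + x ≤ b + y
  +-mono-≤ {a} {b} {x} {y} a≤b x≤y = begin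
    a + x   ≤⟨ +-monoˡ-≤ x a≤b ⟩
    b + x   ≈⟨ +-comm b x ⟩
    x + b   ≤⟨ +-monoˡ-≤ b x≤y ⟩
    y + b   ≈⟨ +-comm y b ⟩
    b + y   ∎

  +-cancelʳ-≤ : ∀ z {x y} → x + z ≤ y + z → x ≤ y
  +-cancelʳ-≤ z {x} {y} x+z≤y+z = begin
    x             ≈⟨ cancel x ⟨
    x + z - z     ≤⟨ +-monoˡ-≤ (- z) x+z≤y+z ⟩
    y + z - z     ≈⟨ cancel y ⟩
    y             ∎
    where
    cancel : ∀ w → w + z - z ≈ w
    cancel w = trans (+-assoc w z (- z)) (trans (+-congˡ (-‿inverseʳ z)) (+-identityʳ w))

  x-y+y≈x : ∀ x y → x - y + y ≈ x
  x-y+y≈x x y = trans (+-assoc x (- y) y) (trans (+-congˡ (-‿inverseˡ y)) (+-identityʳ x))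

  +-nonNeg : ∀ {x y} → 0# ≤ x → 0# ≤ y → 0# ≤ x + y
  +-nonNeg 0≤x 0≤y = ≤-trans (≤-reflexive (sym (+-identityʳ 0#))) (+-mono-≤ 0≤x 0≤y)

  x≤x+y : ∀ {x y} → 0# ≤ y → x ≤ x + y
  x≤x+y {x} 0≤y = ≤-trans (≤-reflexive (sym (+-identityʳ x))) (+-mono-≤ ≤-refl 0≤y)

  x+y≤z⇒x≤z-y : ∀ {x y z} → x + y ≤ z → x ≤ z - y
  x+y≤z⇒x≤z-y {x} {y} {z} x+y≤z =
    +-cancelʳ-≤ y (≤-trans x+y≤z (≤-reflexive (sym (x-y+y≈x z y))))

  x≤y⇒0≤y-x : ∀ {x y} → x ≤ y → 0# ≤ y - x
  x≤y⇒0≤y-x {x} x≤y = x+y≤z⇒x≤z-y (≤-trans (≤-reflexive (+-identityˡ x)) x≤y)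

  x≤y+z⇒x-y≤z : ∀ {x y z} → x ≤ y + z → x - y ≤ z
  x≤y+z⇒x-y≤z {x} {y} {z} x≤y+z = +-cancelʳ-≤ y (begin
    x - y + y   ≈⟨ x-y+y≈x x y ⟩
    x           ≤⟨ x≤y+z ⟩
    y + z       ≈⟨ +-comm y z ⟩
    z + y       ∎)

  x-y≤z⇒x≤y+z : ∀ {x y z} → x - y ≤ z → x ≤ y + z
  x-y≤z⇒x≤y+z {x} {y} {z} x-y≤z = begin
    x           ≈⟨ x-y+y≈x x y ⟨
    x - y + y   ≤⟨ +-monoˡ-≤ y x-y≤z ⟩
    z + y       ≈⟨ +-comm z y ⟩
    y + z       ∎

  *-monoʳ-≤-nonNeg : ∀ {w x y} → 0# ≤ w → x ≤ y → w * x ≤ w * y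
  *-monoʳ-≤-nonNeg {w} {x} {y} 0≤w x≤y = begin
    w * x                 ≤⟨ x≤x+y (*-nonNeg 0≤w (x≤y⇒0≤y-x x≤y)) ⟩
    w * x + w * (y - x)   ≈⟨ distribˡ w x (y - x) ⟨
    w * (x + (y - x))     ≈⟨ *-congˡ (trans (+-comm x (y - x)) (x-y+y≈x y x)) ⟩
    w * y                 ∎

  0≤1 : 0# ≤ 1#
  0≤1 = case ≤-total 0# 1# of λ where
    (inj₁ 0≤1) → 0≤1
    (inj₂ 1≤0) →
      let 0≤-1 = ≤-trans (x≤y⇒0≤y-x 1≤0) (≤-reflexive (+-identityˡ (- 1#))) in
      ≤-trans (*-nonNeg 0≤-1 0≤-1)
        (≤-reflexive (trans (-1*x≈-x (- 1#)) (-‿involutive 1#)))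

  fromℕ-mono : ∀ {i j} → i ℕ.≤ j → fromℕ i ≤ fromℕ j
  fromℕ-mono {j = zero}  ℕ.z≤n       = ≤-refl
  fromℕ-mono {j = suc j} ℕ.z≤n       = +-nonNeg 0≤1 (fromℕ-mono {j = j} ℕ.z≤n)
  fromℕ-mono             (ℕ.s≤s i≤j) = +-mono-≤ ≤-refl (fromℕ-mono i≤j)

  sum-mono : {f g : Vector Carrier m} → (∀ i → f i ≤ g i) → sum f ≤ sum g
  sum-mono {zero}  f≤g = ≤-refl
  sum-mono {suc m} f≤g = +-mono-≤ (f≤g zero) (sum-mono (f≤g ∘ suc))

  sum-nonNeg : {f : Vector Carrier m} → (∀ i → 0# ≤ f i) → 0# ≤ sum f
  sum-nonNeg {zero}  0≤f = ≤-refl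
  sum-nonNeg {suc m} 0≤f = +-nonNeg (0≤f zero) (sum-nonNeg (0≤f ∘ suc))

  sum-↑ : ∀ m {n} (f : Vector Carrier (m ℕ.+ n)) →
    sum f ≈ sum (f ∘ (_↑ˡ n)) + sum (f ∘ (m ↑ʳ_))
  sum-↑ zero    f = sym (+-identityˡ (sum f))
  sum-↑ (suc m) f = trans (+-congˡ (sum-↑ m (f ∘ suc))) (sym (+-assoc _ _ _))

  sum-combine : ∀ m {n} (f : Vector Carrier (m ℕ.* n)) →
    sum f ≈ ∑[ i < m ] ∑[ j < n ] f (combine i j)
  sum-combine zero        f = refl
  sum-combine (suc m) {n} f = trans (sum-↑ n f) (+-congˡ (sum-combine m (f ∘ (n ↑ʳ_))))

  indicator : Bool → Carrier
  indicator b = if b then 1# else 0#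

  fromℕ-bit : ∀ b → fromℕ (bit b) ≈ indicator b
  fromℕ-bit true  = +-identityʳ 1#
  fromℕ-bit false = refl

  fromℕ-count : (b : Fin m → Bool) → fromℕ (count b) ≈ ∑[ u < m ] indicator (b u)
  fromℕ-count {zero}  b = refl
  fromℕ-count {suc m} b = begin-equality
    fromℕ (count b)                                    ≡⟨ ≡.cong fromℕ (count-suc b) ⟩
    fromℕ (bit (b zero) ℕ.+ count (b ∘ suc))           ≈⟨ ×-homo-+ 1# (bit (b zero)) _ ⟩
    fromℕ (bit (b zero)) + fromℕ (count (b ∘ suc))     ≈⟨ +-cong (fromℕ-bit (b zero)) (fromℕ-count (b ∘ suc)) ⟩
    indicator (b zero) + sum (indicator ∘ b ∘ suc)     ∎

  -- Unit vectors and the functionals x(A).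

  unit : Fin n → Point K n
  unit w v = indicator (does (w Fin.≟ v))

  fromℕ-inDegree : (β : Fin n → Fin n) (v : Fin n) →
    fromℕ (inDegree β v) ≈ ∑[ u < n ] unit (β u) v
  fromℕ-inDegree β v = fromℕ-count (λ u → does (β u Fin.≟ v))

  restrict : Point K n → Subset n → Point K n
  restrict x A v = if lookup A v then x v else 0#

  total-restrict : (x : Point K n) (A : Subset n) → total K x A ≈ sum (restrict x A)
  total-restrict x A =
    sum-cong-≋ λ v → reflexive (≡.cong (if_then x v else 0#) (does-∈? v A))

  total-cong : {x y : Point K n} → (∀ v → x v ≈ y v) → ∀ A → total K x A ≈ total K y A
  total-cong x≈y A = sum-cong-≋ λ v → restricted (does (v ∈? A)) (x≈y v)
    where
    restricted : ∀ b {a a′} → a ≈ a′ → (if b then a else 0#) ≈ (if b then a′ else 0#)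
    restricted true  a≈a′ = a≈a′
    restricted false a≈a′ = refl

  total-+ : (x y : Point K n) (A : Subset n) →
    total K (λ v → x v + y v) A ≈ total K x A + total K y A
  total-+ {n} x y A = trans (sum-cong-≋ λ v → restricted (does (v ∈? A)) (x v) (y v))
                        (∑-distrib-+ {n} _ _)
    where
    restricted : ∀ b a a′ → (if b then a + a′ else 0#) ≈
                            (if b then a else 0#) + (if b then a′ else 0#)
    restricted true  a a′ = refl
    restricted false a a′ = sym (+-identityʳ 0#)

  total-* : ∀ w (x : Point K n) (A : Subset n) →
    total K (λ v → w * x v) A ≈ w * total K x A
  total-* {n} w x A = trans (sum-cong-≋ λ v → restricted (does (v ∈? A)) (x v))
                        (sym (*-distribˡ-sum {n} w _))
    where
    restricted : ∀ b a → (if b then w * a else 0#) ≈ w * (if b then a else 0#)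
    restricted true  a = refl
    restricted false a = sym (zeroʳ w)

  total-0 : (A : Subset n) → total K (λ _ → 0#) A ≈ 0#
  total-0 {n} A = trans (sum-cong-≋ λ v → restricted (does (v ∈? A))) (sum-replicate-zero n)
    where
    restricted : ∀ b → (if b then 0# else 0#) ≈ 0#
    restricted true  = refl
    restricted false = refl

  total-sum : (p : Fin m → Point K n) (A : Subset n) →
    total K (λ v → ∑[ i < m ] p i v) A ≈ ∑[ i < m ] total K (p i) A
  total-sum {zero}  p A = total-0 A
  total-sum {suc m} p A = trans (total-+ (p zero) _ A) (+-congˡ (total-sum (p ∘ suc) A))

  total-unit : (w : Fin n) (A : Subset n) → total K (unit w) A ≈ indicator (lookup A w)
  total-unit zero    (inside  ∷ A) = trans (+-congˡ (total-0 A)) (+-identityʳ 1#)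
  total-unit zero    (outside ∷ A) = trans (+-congˡ (total-0 A)) (+-identityʳ 0#)
  total-unit (suc w) (inside  ∷ A) = trans (+-identityˡ _) (total-unit w A)
  total-unit (suc w) (outside ∷ A) = trans (+-identityˡ _) (total-unit w A)

  total-modular : (x : Point K n) (A B : Subset n) →
    total K x (A ∪ B) + total K x (A ∩ B) ≈ total K x A + total K x B
  total-modular x A B = begin-equality
    total K x (A ∪ B) + total K x (A ∩ B)
      ≈⟨ +-cong (total-restrict x (A ∪ B)) (total-restrict x (A ∩ B)) ⟩
    sum (restrict x (A ∪ B)) + sum (restrict x (A ∩ B))
      ≈⟨ ∑-distrib-+ (restrict x (A ∪ B)) (restrict x (A ∩ B)) ⟨
    sum (λ v → restrict x (A ∪ B) v + restrict x (A ∩ B) v)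
      ≈⟨ sum-cong-≋ pointwise ⟩
    sum (λ v → restrict x A v + restrict x B v)
      ≈⟨ ∑-distrib-+ (restrict x A) (restrict x B) ⟩
    sum (restrict x A) + sum (restrict x B)
      ≈⟨ +-cong (total-restrict x A) (total-restrict x B) ⟨
    total K x A + total K x B ∎
    where
    pointwise : ∀ v → restrict x (A ∪ B) v + restrict x (A ∩ B) v ≈ restrict x A v + restrict x B v
    pointwise v rewrite lookup-zipWith _∨_ v A B | lookup-zipWith _∧_ v A B
      with lookup A v | lookup B v
    ... | true  | true  = refl
    ... | true  | false = refl
    ... | false | true  = +-comm (x v) 0#
    ... | false | false = refl

  total-remove : (x : Point K n) (A : Subset n) {v : Fin n} → lookup A v ≡ true →
    total K x A ≈ total K x (A [ v ]≔ outside) + x v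
  total-remove x (inside ∷ A) {zero}  v∈A = begin-equality
    x zero + total K (x ∘ suc) A          ≈⟨ +-comm _ _ ⟩
    total K (x ∘ suc) A + x zero          ≈⟨ +-congʳ (+-identityˡ _) ⟨
    0# + total K (x ∘ suc) A + x zero     ∎
  total-remove x (inside ∷ A)  {suc v} v∈A =
    trans (+-congˡ (total-remove (x ∘ suc) A v∈A)) (sym (+-assoc _ _ _))
  total-remove x (outside ∷ A) {suc v} v∈A =
    trans (+-congˡ (total-remove (x ∘ suc) A v∈A)) (sym (+-assoc _ _ _))

  total-nonNeg : {x : Point K n} → (∀ v → 0# ≤ x v) → ∀ A → 0# ≤ total K x A
  total-nonNeg 0≤x A = sum-nonNeg λ v → restricted (does (v ∈? A)) (0≤x v)
    where
    restricted : ∀ b {a} → 0# ≤ a → 0# ≤ (if b then a else 0#)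
    restricted true  0≤a = 0≤a
    restricted false 0≤a = ≤-refl

  coordinate≤total : {x : Point K n} → (∀ v → 0# ≤ x v) → ∀ v → x v ≤ total K x ⊤
  coordinate≤total {x = x} 0≤x v = begin
    x v                                   ≤⟨ x≤x+y (total-nonNeg 0≤x (⊤ [ v ]≔ outside)) ⟩
    x v + total K x (⊤ [ v ]≔ outside)    ≈⟨ +-comm _ _ ⟩
    total K x (⊤ [ v ]≔ outside) + x v    ≈⟨ total-remove x ⊤ (lookup-replicate v inside) ⟨
    total K x ⊤                           ∎

  -- Least slack, and splitting off one simplex.

  supremum : (φ : Subset n → Carrier) →
    ∃[ ε ] (0# ≤ ε × (∀ A → φ A ≤ ε) × (∀ {M} → 0# ≤ M → (∀ A → φ A ≤ M) → ε ≤ M))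
  supremum {zero} φ with ≤-total 0# (φ [])
  ... | inj₁ 0≤φ = φ [] , 0≤φ , (λ where [] → ≤-refl) , λ _ φ≤M → φ≤M []
  ... | inj₂ φ≤0 = 0# , ≤-refl , (λ where [] → φ≤0) , λ 0≤M _ → 0≤M
  supremum {suc n} φ
    with ε , 0≤ε , φ≤ε , ε-least ← supremum (φ ∘ (inside ∷_))
       | δ , 0≤δ , φ≤δ , δ-least ← supremum (φ ∘ (outside ∷_))
    with ≤-total ε δ
  ... | inj₁ ε≤δ = δ , 0≤δ
      , (λ where (inside  ∷ A) → ≤-trans (φ≤ε A) ε≤δ
                 (outside ∷ A) → φ≤δ A)
      , λ 0≤M φ≤M → δ-least 0≤M (φ≤M ∘ (outside ∷_))
  ... | inj₂ δ≤ε = ε , 0≤ε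
      , (λ where (inside  ∷ A) → φ≤ε A
                 (outside ∷ A) → ≤-trans (φ≤δ A) δ≤ε)
      , λ 0≤M φ≤M → ε-least 0≤M (φ≤M ∘ (inside ∷_))

  -- `supremum` is the maximum of finitely many values together with 0. Sets outside `b` can
  -- therefore be given the value 0 without affecting it, and an empty family gives slack 0.
  leastSlack : (b : Subset n → Bool) (p q : Subset n → Carrier) →
    ∃[ ε ] (0# ≤ ε × (∀ A → b A ≡ true → p A ≤ q A + ε) ×
      (∀ {M} → 0# ≤ M → (∀ A → b A ≡ true → p A ≤ q A + M) → ε ≤ M))
  leastSlack b p q with supremum (λ A → if b A then p A - q A else 0#)
  ... | ε , 0≤ε , φ≤ε , ε-least = ε , 0≤ε
    , (λ A bA → x-y≤z⇒x≤y+z (≡.subst (λ t → (if t then p A - q A else 0#) ≤ ε) bA (φ≤ε A)))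
    , λ {M} 0≤M p≤q+M → ε-least 0≤M λ A → least 0≤M (b A) (p≤q+M A)
    where
    least : ∀ {M} → 0# ≤ M → ∀ t {y z} → (t ≡ true → y ≤ z + M) → (if t then y - z else 0#) ≤ M
    least 0≤M true  y≤z+M = x≤y+z⇒x-y≤z (y≤z+M ≡.refl)
    least 0≤M false y≤z+M = 0≤M

  -- The capacity that a source with supply `c` adds to a set: all of it if the set contains a
  -- vertex within reach, nothing otherwise.
  charge : Bool → Carrier → Carrier
  charge b c = if b then c else 0#

  -- Shares are indexed by positions in `N`, so repeated entries do no harm. `share-sum` is only a
  -- bound, since supply may remain when `N` is exhausted; `polymatroid⊆Conv` recovers equality from
  -- the coordinate sum.
  record Peeling (f : Subset n → ℕ) (N : List (Fin n)) (c : Carrier) (x : Point K n)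
      : Set (k ⊔ ℓ₁ ⊔ ℓ₂) where
    field
      share         : Vector Carrier (length N)
      rest          : Point K n
      share-nonNeg  : ∀ i → 0# ≤ share i
      share-sum     : sum share ≤ c
      rest∈P        : polymatroidPolytope K f rest
      decomposition : ∀ v → x v ≈ ∑[ i < length N ] (share i * unit (List.lookup N i) v) + rest v

  module _ {f : Subset n → ℕ} (f-poly : IsPolymatroid f) where
    open IsPolymatroid f-poly

    private
      ⌊_⌋ : Subset n → Carrier
      ⌊ A ⌋ = fromℕ (f A)

    -- Vertex v receives the least amount ε that must come from this source once
    -- the remaining vertices N are the only others it can serve; uncrossing a set
    -- forcing ε with a set bounding it shows that ε is not too large.
    peel : ∀ N {c} {x : Point K n} → 0# ≤ c → (∀ v → 0# ≤ x v) →
      (∀ A → total K x A ≤ ⌊ A ⌋ + charge (hits N A) c) → Peeling f N c x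
    peel [] {c} {x} 0≤c 0≤x x≤ = record
      { share         = Vector.[]
      ; rest          = x
      ; share-nonNeg  = λ ()
      ; share-sum     = 0≤c
      ; rest∈P        = 0≤x , λ A → ≤-trans (x≤ A) (≤-reflexive (+-identityʳ ⌊ A ⌋))
      ; decomposition = λ v → sym (+-identityˡ (x v))
      }
    peel (v ∷ N) {c} {x} 0≤c 0≤x x≤ = record
      { share         = ε Vector.∷ share
      ; rest          = rest
      ; share-nonNeg  = λ where zero    → 0≤ε
                                (suc i) → share-nonNeg i
      ; share-sum     = begin
          ε + sum share   ≤⟨ +-mono-≤ ≤-refl share-sum ⟩
          ε + (c - ε)     ≈⟨ trans (+-comm ε (c - ε)) (x-y+y≈x c ε) ⟩
          c               ∎
      ; rest∈P        = rest∈P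
      ; decomposition = λ u → begin-equality
          x u                        ≈⟨ x≈ε+x′ u ⟩
          ε * unit v u + x′ u        ≈⟨ +-congˡ (decomposition u) ⟩
          _                          ≈⟨ +-assoc _ _ _ ⟨
          _                          ∎
      }
      where
      served : ∀ A → lookup A v ∨ hits N A ≡ true → total K x A ≤ ⌊ A ⌋ + c
      served A hit = ≡.subst (λ b → total K x A ≤ ⌊ A ⌋ + charge b c) hit (x≤ A)

      unserved : ∀ A → lookup A v ∨ hits N A ≡ false → total K x A ≤ ⌊ A ⌋
      unserved A miss = ≤-trans
        (≡.subst (λ b → total K x A ≤ ⌊ A ⌋ + charge b c) miss (x≤ A))
        (≤-reflexive (+-identityʳ ⌊ A ⌋))

      -- For such sets `v` is the last chance: no later vertex of the list lies in them, so any
      -- excess of x(A) over f(A) has to be delivered at `v`.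
      forcing : Subset n → Bool
      forcing A = lookup A v ∧ not (hits N A)

      forcing⁻ : ∀ A → forcing A ≡ true → lookup A v ≡ true × hits N A ≡ false
      forcing⁻ A forced with lookup A v | hits N A
      ... | true | false = ≡.refl , ≡.refl

      slack = leastSlack forcing (total K x) ⌊_⌋
      ε = proj₁ slack
      0≤ε = proj₁ (proj₂ slack)
      ε-sufficient = proj₁ (proj₂ (proj₂ slack))
      ε-least = proj₂ (proj₂ (proj₂ slack))

      -- This bound on `ε` and the next two come from leastness: each upper bound is shown to be
      -- enough slack for every forcing set.
      ε≤c : ε ≤ c
      ε≤c = ε-least 0≤c λ A forced →
        served A (≡.cong (_∨ hits N A) (proj₁ (forcing⁻ A forced)))

      -- Without `v`, a forcing set is out of reach of the source and obeys the bound by `f` alone;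
      -- the excess is thus at most the coordinate at `v`.
      ε≤xv : ε ≤ x v
      ε≤xv = ε-least (0≤x v) λ A forced →
        let v∈A , N∩A=∅ = forcing⁻ A forced
            A-v = A [ v ]≔ outside
            A-v⊆A = remove-⊆ A v in begin
        total K x A             ≈⟨ total-remove x A v∈A ⟩
        total K x A-v + x v     ≤⟨ +-monoˡ-≤ (x v) (unserved A-v
                                     (≡.cong₂ _∨_ (lookup∘update v A outside) (hits-antimono N A-v⊆A N∩A=∅))) ⟩
        ⌊ A-v ⌋ + x v           ≤⟨ +-monoˡ-≤ (x v) (fromℕ-mono (monotone A-v A A-v⊆A)) ⟩
        ⌊ A ⌋ + x v             ∎

      -- Delivering at `v` shrinks the supply available to `A` but not its demand. Against a forcing
      -- set `B`, the union is charged `c`, while the intersection avoids `v` because of `A` and `N`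
      -- because of `B`. So `c` enters only once, and submodularity bounds the excess of `B` by the
      -- room left in `A`.
      ε≤residual : ∀ A → lookup A v ≡ false → hits N A ≡ true → total K x A + ε ≤ ⌊ A ⌋ + c
      ε≤residual A v∉A N∩A≠∅ = begin
        total K x A + ε                             ≤⟨ +-mono-≤ ≤-refl bound ⟩
        total K x A + (⌊ A ⌋ + c - total K x A)     ≈⟨ trans (+-comm _ _) (x-y+y≈x _ _) ⟩
        ⌊ A ⌋ + c                                   ∎
        where
        bound : ε ≤ ⌊ A ⌋ + c - total K x A
        bound = ε-least (x≤y⇒0≤y-x (served A (≡.cong₂ _∨_ v∉A N∩A≠∅))) λ B forced →
          let v∈B , N∩B=∅ = forcing⁻ B forced
              v∉A∩B = ≡.trans (lookup-zipWith _∧_ v A B) (≡.cong (_∧ lookup B v) v∉A)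
              v∈A∪B = ≡.trans (lookup-zipWith _∨_ v A B) (≡.cong₂ _∨_ v∉A v∈B) in
          +-cancelʳ-≤ (total K x A) (begin
            total K x B + total K x A               ≈⟨ trans (+-comm _ _) (sym (total-modular x A B)) ⟩
            total K x (A ∪ B) + total K x (A ∩ B)   ≤⟨ +-mono-≤
                                                         (served (A ∪ B) (≡.cong (_∨ hits N (A ∪ B)) v∈A∪B))
                                                         (unserved (A ∩ B) (≡.cong₂ _∨_ v∉A∩B
                                                           (hits-antimono N (p∩q⊆q A B) N∩B=∅))) ⟩
            ⌊ A ∪ B ⌋ + c + ⌊ A ∩ B ⌋               ≈⟨ solve 3 (λ p q r → ((p ⊕ q) ⊕ r) ⊜ ((p ⊕ r) ⊕ q)) refl _ _ _ ⟩
            ⌊ A ∪ B ⌋ + ⌊ A ∩ B ⌋ + c               ≈⟨ +-congʳ (×-homo-+ 1# (f (A ∪ B)) (f (A ∩ B))) ⟨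
            fromℕ (f (A ∪ B) ℕ.+ f (A ∩ B)) + c     ≤⟨ +-monoˡ-≤ c (fromℕ-mono (submodular A B)) ⟩
            fromℕ (f A ℕ.+ f B) + c                 ≈⟨ +-congʳ (×-homo-+ 1# (f A) (f B)) ⟩
            ⌊ A ⌋ + ⌊ B ⌋ + c                       ≈⟨ solve 3 (λ p q r → ((p ⊕ q) ⊕ r) ⊜ (q ⊕ (p ⊕ r))) refl _ _ _ ⟩
            ⌊ B ⌋ + (⌊ A ⌋ + c)                     ≈⟨ +-congˡ (x-y+y≈x (⌊ A ⌋ + c) (total K x A)) ⟨
            ⌊ B ⌋ + (⌊ A ⌋ + c - total K x A + total K x A)   ≈⟨ +-assoc _ _ _ ⟨
            ⌊ B ⌋ + (⌊ A ⌋ + c - total K x A) + total K x A   ∎)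

      x′ : Point K n
      x′ u = x u - ε * unit v u

      x≈ε+x′ : ∀ u → x u ≈ ε * unit v u + x′ u
      x≈ε+x′ u = sym (trans (+-comm _ _) (x-y+y≈x (x u) (ε * unit v u)))

      0≤x′ : ∀ u → 0# ≤ x′ u
      0≤x′ u with v Fin.≟ u
      ... | yes ≡.refl = x≤y⇒0≤y-x (≤-trans (≤-reflexive (*-identityʳ ε)) ε≤xv)
      ... | no  _      = x≤y⇒0≤y-x (≤-trans (≤-reflexive (zeroʳ ε)) (0≤x u))

      total-x′ : ∀ A → total K x A ≈ charge (lookup A v) ε + total K x′ A
      total-x′ A = begin-equality
        total K x A                                        ≈⟨ total-cong x≈ε+x′ A ⟩
        total K (λ u → ε * unit v u + x′ u) A              ≈⟨ total-+ _ x′ A ⟩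
        total K (λ u → ε * unit v u) A + total K x′ A      ≈⟨ +-congʳ (total-* ε (unit v) A) ⟩
        ε * total K (unit v) A + total K x′ A              ≈⟨ +-congʳ (*-congˡ (total-unit v A)) ⟩
        ε * indicator (lookup A v) + total K x′ A          ≈⟨ +-congʳ (charged (lookup A v)) ⟩
        charge (lookup A v) ε + total K x′ A               ∎
        where
        charged : ∀ b → ε * indicator b ≈ charge b ε
        charged true  = *-identityʳ ε
        charged false = zeroʳ ε

      -- The left side drops by `ε` exactly when `v` is in `A`. If `A` meets `N`, the charge drops
      -- from `c` to `c - ε`; if `A` contains `v` but misses `N`, it vanishes, which is what
      -- `ε-sufficient` allows for. The case of `A` meeting `N` without `v` is `ε≤residual`.
      x′≤ : ∀ A → total K x′ A ≤ ⌊ A ⌋ + charge (hits N A) (c - ε)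
      x′≤ A with lookup A v in v∈A | hits N A in N∩A | total-x′ A
      ... | true | true | x≈ = +-cancelʳ-≤ ε (begin
        total K x′ A + ε        ≈⟨ +-comm _ _ ⟩
        ε + total K x′ A        ≈⟨ x≈ ⟨
        total K x A             ≤⟨ served A (≡.cong (_∨ hits N A) v∈A) ⟩
        ⌊ A ⌋ + c               ≈⟨ +-congˡ (x-y+y≈x c ε) ⟨
        ⌊ A ⌋ + (c - ε + ε)     ≈⟨ +-assoc _ _ _ ⟨
        ⌊ A ⌋ + (c - ε) + ε     ∎)
      ... | true | false | x≈ = +-cancelʳ-≤ ε (begin
        total K x′ A + ε        ≈⟨ +-comm _ _ ⟩
        ε + total K x′ A        ≈⟨ x≈ ⟨
        total K x A             ≤⟨ ε-sufficient A (≡.cong₂ (λ a b → a ∧ not b) v∈A N∩A) ⟩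
        ⌊ A ⌋ + ε               ≈⟨ +-congʳ (+-identityʳ ⌊ A ⌋) ⟨
        ⌊ A ⌋ + 0# + ε          ∎)
      ... | false | true | x≈ = +-cancelʳ-≤ ε (begin
        total K x′ A + ε        ≈⟨ +-congʳ (trans x≈ (+-identityˡ _)) ⟨
        total K x A + ε         ≤⟨ ε≤residual A v∈A N∩A ⟩
        ⌊ A ⌋ + c               ≈⟨ +-congˡ (x-y+y≈x c ε) ⟨
        ⌊ A ⌋ + (c - ε + ε)     ≈⟨ +-assoc _ _ _ ⟨
        ⌊ A ⌋ + (c - ε) + ε     ∎)
      ... | false | false | x≈ = begin
        total K x′ A            ≈⟨ trans x≈ (+-identityˡ _) ⟨
        total K x A             ≤⟨ unserved A (≡.cong₂ _∨_ v∈A N∩A) ⟩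
        ⌊ A ⌋                   ≈⟨ +-identityʳ ⌊ A ⌋ ⟨
        ⌊ A ⌋ + 0#              ∎

      open Peeling (peel N (x≤y⇒0≤y-x ε≤c) 0≤x′ x′≤)

  -- Convex hulls, Minkowski sums and base polytopes.

  sum-remQuot : (h : Fin m → Fin n → Carrier) →
    sum (λ k → uncurry h (remQuot {m} n k)) ≈ ∑[ i < m ] ∑[ j < n ] h i j
  sum-remQuot {m} {n} h = trans (sum-combine m _)
    (sum-cong-≋ λ i → sum-cong-≋ λ j →
      reflexive (≡.cong (uncurry h) (Fin.remQuot-combine i j)))

  Conv-point : {P : Pred (Point K n) ℓ} {x p : Point K n} →
    P p → (∀ v → x v ≈ p v) → Conv K P x
  Conv-point {p = p} p∈P x≈p = record
    { size          = 1
    ; point         = λ _ → p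
    ; weight        = λ _ → 1#
    ; point∈P       = λ _ → p∈P
    ; weight-nonNeg = λ _ → 0≤1
    ; weight-sum    = +-identityʳ 1#
    ; combination   = λ v →
        trans (x≈p v) (sym (trans (+-identityʳ (1# * p v)) (*-identityˡ (p v))))
    }

  -- Product weights on all pairs of points work because each family of weights sums to 1. With a
  -- one-point hull as one summand this is a translation.
  Conv-+ : {P : Pred (Point K n) ℓ} {Q : Pred (Point K n) ℓ′} {R : Pred (Point K n) ℓ″}
    {x y z : Point K n} → (∀ {p q} → P p → Q q → R (λ v → p v + q v)) →
    Conv K P x → Conv K Q y → (∀ v → z v ≈ x v + y v) → Conv K R z
  Conv-+ {x = x} {y} {z} P+Q⊆R convP convQ z≈x+y = record
    { size          = P.size ℕ.* Q.size
    ; point         = λ k v → P.point (row k) v + Q.point (column k) v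
    ; weight        = λ k → P.weight (row k) * Q.weight (column k)
    ; point∈P       = λ k → P+Q⊆R (P.point∈P (row k)) (Q.point∈P (column k))
    ; weight-nonNeg = λ k → *-nonNeg (P.weight-nonNeg (row k)) (Q.weight-nonNeg (column k))
    ; weight-sum    = begin-equality
        sum (λ k → P.weight (row k) * Q.weight (column k))
          ≈⟨ sum-remQuot {P.size} (λ i j → P.weight i * Q.weight j) ⟩
        ∑[ i < P.size ] ∑[ j < Q.size ] (P.weight i * Q.weight j)
          ≈⟨ sum-cong-≋ (λ i → *-distribˡ-sum (P.weight i) Q.weight) ⟨
        ∑[ i < P.size ] (P.weight i * sum Q.weight)
          ≈⟨ sum-cong-≋ (λ i → trans (*-congˡ Q.weight-sum) (*-identityʳ (P.weight i))) ⟩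
        sum P.weight
          ≈⟨ P.weight-sum ⟩
        1# ∎
    ; combination   = λ v → begin-equality
        z v
          ≈⟨ z≈x+y v ⟩
        x v + y v
          ≈⟨ +-cong (P.combination v)
               (trans (sym (*-identityˡ (y v)))
                 (trans (*-congʳ (sym P.weight-sum)) (*-distribʳ-sum (y v) P.weight))) ⟩
        (∑[ i < P.size ] (P.weight i * P.point i v)) + (∑[ i < P.size ] (P.weight i * y v))
          ≈⟨ ∑-distrib-+ (λ i → P.weight i * P.point i v) _ ⟨
        ∑[ i < P.size ] (P.weight i * P.point i v + P.weight i * y v)
          ≈⟨ sum-cong-≋ (λ i → expand (P.weight i) (P.point i v) v) ⟩
        ∑[ i < P.size ] ∑[ j < Q.size ] (P.weight i * Q.weight j * (P.point i v + Q.point j v))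
          ≈⟨ sum-remQuot {P.size} (λ i j → P.weight i * Q.weight j * (P.point i v + Q.point j v)) ⟨
        _ ∎
    }
    where
    module P = Conv convP
    module Q = Conv convQ
    row    = λ k → proj₁ (remQuot {P.size} Q.size k)
    column = λ k → proj₂ (remQuot {P.size} Q.size k)
    expand : ∀ a p v →
      a * p + a * y v ≈ ∑[ j < Q.size ] (a * Q.weight j * (p + Q.point j v))
    expand a p v = begin-equality
      a * p + a * y v
        ≈⟨ distribˡ a p (y v) ⟨
      a * (p + y v)
        ≈⟨ *-congˡ (+-cong (trans (sym (*-identityˡ p)) (*-congʳ (sym Q.weight-sum)))
                           (Q.combination v)) ⟩
      a * (sum Q.weight * p + ∑[ j < Q.size ] (Q.weight j * Q.point j v))
        ≈⟨ *-congˡ (+-congʳ (*-distribʳ-sum p Q.weight)) ⟩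
      a * ((∑[ j < Q.size ] (Q.weight j * p)) + (∑[ j < Q.size ] (Q.weight j * Q.point j v)))
        ≈⟨ *-congˡ (∑-distrib-+ (λ j → Q.weight j * p) _) ⟨
      a * (∑[ j < Q.size ] (Q.weight j * p + Q.weight j * Q.point j v))
        ≈⟨ *-distribˡ-sum {Q.size} a _ ⟩
      ∑[ j < Q.size ] (a * (Q.weight j * p + Q.weight j * Q.point j v))
        ≈⟨ sum-cong-≋ (λ j → trans (*-congˡ (sym (distribˡ (Q.weight j) p (Q.point j v))))
                                   (sym (*-assoc a (Q.weight j) _))) ⟩
      ∑[ j < Q.size ] (a * Q.weight j * (p + Q.point j v)) ∎

  -- The sums of one vertex of the simplex Δ(N u) for each source u.
  ChoiceSum : (Fin m → List (Fin n)) → Pred (Point K n) ℓ₁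
  ChoiceSum {m} {n} N p =
    Σ[ β ∈ (Fin m → Fin n) ] ((∀ u → β u ∈ N u) × (∀ v → p v ≈ ∑[ u < m ] unit (β u) v))

  -- Induction on the number of sources, over a fixed vertex set. A coverage by `m` sources never
  -- exceeds `m`, so a total of at least `suc m` forces the first source to deliver its whole unit
  -- and leaves at least `m` for the others.
  polymatroid⊆Conv : (N : Fin m → List (Fin n)) {x : Point K n} →
    polymatroidPolytope K (coverage N) x → fromℕ m ≤ total K x ⊤ → Conv K (ChoiceSum N) x
  polymatroid⊆Conv {zero} N {x} (0≤x , x≤) _ =
    Conv-point {p = λ _ → 0#} ((λ ()) , (λ ()) , λ _ → refl) λ v →
      -- Without sources the coverage is 0, and each coordinate is squeezed to 0.
      antisym (≤-trans (coordinate≤total 0≤x v) (x≤ ⊤)) (0≤x v)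
  polymatroid⊆Conv {suc m} {n} N {x} (0≤x , x≤) m≤x =
    Conv-+ extend simplex (polymatroid⊆Conv (N ∘ suc) rest∈P m≤rest) decomposition
    where
    target : Fin (length (N zero)) → Fin n
    target = List.lookup (N zero)

    open Peeling (peel (coverage-isPolymatroid (N ∘ suc)) (N zero) {1#} 0≤1 0≤x λ A → begin
      total K x A
        ≤⟨ x≤ A ⟩
      fromℕ (coverage N A)
        ≡⟨ ≡.cong fromℕ (count-suc (λ u → hits (N u) A)) ⟩
      fromℕ (bit (hits (N zero) A) ℕ.+ coverage (N ∘ suc) A)
        ≈⟨ ×-homo-+ 1# (bit (hits (N zero) A)) _ ⟩
      fromℕ (bit (hits (N zero) A)) + fromℕ (coverage (N ∘ suc) A)
        ≈⟨ trans (+-congʳ (fromℕ-bit (hits (N zero) A))) (+-comm _ _) ⟩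
      fromℕ (coverage (N ∘ suc) A) + charge (hits (N zero) A) 1# ∎)

    rest≤m : total K rest ⊤ ≤ fromℕ m
    rest≤m = ≤-trans (proj₂ rest∈P ⊤) (fromℕ-mono (count≤ (λ u → hits (N (suc u)) ⊤)))

    total-x : total K x ⊤ ≈ sum share + total K rest ⊤
    total-x = begin-equality
      total K x ⊤
        ≈⟨ total-cong decomposition ⊤ ⟩
      _
        ≈⟨ total-+ _ rest ⊤ ⟩
      total K (λ v → ∑[ i < length (N zero) ] (share i * unit (target i) v)) ⊤ + total K rest ⊤
        ≈⟨ +-congʳ (total-sum (λ i v → share i * unit (target i) v) ⊤) ⟩
      (∑[ i < length (N zero) ] total K (λ v → share i * unit (target i) v) ⊤) + total K rest ⊤
        ≈⟨ +-congʳ (sum-cong-≋ λ i → begin-equality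
             total K (λ v → share i * unit (target i) v) ⊤   ≈⟨ total-* (share i) (unit (target i)) ⊤ ⟩
             share i * total K (unit (target i)) ⊤           ≈⟨ *-congˡ (total-unit (target i) ⊤) ⟩
             share i * indicator (lookup ⊤ (target i))       ≡⟨ ≡.cong (λ b → share i * indicator b)
                                                                                (lookup-replicate (target i) inside) ⟩
             share i * 1#                                                  ≈⟨ *-identityʳ (share i) ⟩
             share i                                                       ∎) ⟩
      sum share + total K rest ⊤ ∎

    m≤rest : fromℕ m ≤ total K rest ⊤
    m≤rest = +-cancelʳ-≤ 1# (begin
      fromℕ m + 1#                  ≈⟨ +-comm _ _ ⟩
      1# + fromℕ m                  ≤⟨ m≤x ⟩
      total K x ⊤                   ≈⟨ total-x ⟩
      sum share + total K rest ⊤    ≤⟨ +-monoˡ-≤ _ share-sum ⟩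
      1# + total K rest ⊤           ≈⟨ +-comm _ _ ⟩
      total K rest ⊤ + 1#           ∎)

    1≤share : 1# ≤ sum share
    1≤share = +-cancelʳ-≤ (fromℕ m) (begin
      1# + fromℕ m                  ≤⟨ m≤x ⟩
      total K x ⊤                   ≈⟨ total-x ⟩
      sum share + total K rest ⊤    ≤⟨ +-mono-≤ ≤-refl rest≤m ⟩
      sum share + fromℕ m           ∎)

    simplex : Conv K (λ p → ∃[ i ] (p ≡ unit (target i)))
                (λ v → ∑[ i < length (N zero) ] (share i * unit (target i) v))
    simplex = record
      { point∈P       = λ i → i , ≡.refl
      ; weight-nonNeg = share-nonNeg
      ; weight-sum    = antisym share-sum 1≤share
      ; combination   = λ v → refl
      }

    extend : {p q : Point K n} → ∃[ i ] (p ≡ unit (target i)) → ChoiceSum (N ∘ suc) q →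
      ChoiceSum N (λ v → p v + q v)
    extend (i , ≡.refl) (β , β∈N , q≈) =
      (target i Vector.∷ β)
      , (λ where zero    → ∈-lookup i
                 (suc u) → β∈N u)
      , λ v → +-congˡ (q≈ v)

  -- p(A) counts the sources `u` with `β u` in `A`, and for each of these `N u` meets `A`. At `⊤`
  -- every source counts on both sides, which gives the equality.
  choiceSum⊆base : (N : Fin m → List (Fin n)) {p : Point K n} →
    ChoiceSum N p → basePolytope K (coverage N) p
  choiceSum⊆base {m} N {p} (β , β∈N , p≈) =
    (nonNeg , λ A → begin
      total K p A                              ≈⟨ total-p A ⟩
      ∑[ u < m ] indicator (lookup A (β u))    ≤⟨ sum-mono (λ u → indicator-mono (hits-∈ A (β∈N u))) ⟩
      ∑[ u < m ] indicator (hits (N u) A)      ≈⟨ fromℕ-count (λ u → hits (N u) A) ⟨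
      fromℕ (coverage N A)                     ∎)
    , (begin-equality
      total K p ⊤                              ≈⟨ total-p ⊤ ⟩
      ∑[ u < m ] indicator (lookup ⊤ (β u))    ≡⟨ sum-cong-≗ (λ u → ≡.cong indicator (≡.trans (β∈⊤ u)
                                                    (≡.sym (hits-∈ ⊤ (β∈N u) (β∈⊤ u))))) ⟩
      ∑[ u < m ] indicator (hits (N u) ⊤)      ≈⟨ fromℕ-count (λ u → hits (N u) ⊤) ⟨
      fromℕ (coverage N ⊤)                     ∎)
    where
    β∈⊤ : ∀ u → lookup ⊤ (β u) ≡ true
    β∈⊤ u = lookup-replicate (β u) inside

    0≤indicator : ∀ b → 0# ≤ indicator b
    0≤indicator true  = 0≤1
    0≤indicator false = ≤-refl

    indicator-mono : ∀ {a b} → (a ≡ true → b ≡ true) → indicator a ≤ indicator b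
    indicator-mono {false} {b} a⇒b = 0≤indicator b
    indicator-mono {true}      a⇒b rewrite a⇒b ≡.refl = ≤-refl

    nonNeg : ∀ v → 0# ≤ p v
    nonNeg v = ≤-trans (sum-nonNeg λ u → 0≤indicator (does (β u Fin.≟ v)))
                       (≤-reflexive (sym (p≈ v)))

    total-p : ∀ A → total K p A ≈ ∑[ u < m ] indicator (lookup A (β u))
    total-p A = trans (total-cong p≈ A)
      (trans (total-sum (unit ∘ β) A) (sum-cong-≋ λ u → total-unit (β u) A))

  Conv⊆base : {f : Subset n → ℕ} {P : Pred (Point K n) ℓ} {x : Point K n} →
    (∀ {p} → P p → basePolytope K f p) → Conv K P x → basePolytope K f x
  Conv⊆base {f = f} {x = x} P⊆base conv =
    (nonNeg , λ A → begin
      total K x A                                         ≈⟨ total-x A ⟩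
      ∑[ i < size ] (weight i * total K (point i) A)      ≤⟨ sum-mono (λ i → *-monoʳ-≤-nonNeg (weight-nonNeg i)
                                                               (proj₂ (proj₁ (P⊆base (point∈P i))) A)) ⟩
      ∑[ i < size ] (weight i * fromℕ (f A))              ≈⟨ average (fromℕ (f A)) ⟩
      fromℕ (f A)                                         ∎)
    , (begin-equality
      total K x ⊤                                         ≈⟨ total-x ⊤ ⟩
      ∑[ i < size ] (weight i * total K (point i) ⊤)      ≈⟨ sum-cong-≋ (λ i → *-congˡ (proj₂ (P⊆base (point∈P i)))) ⟩
      ∑[ i < size ] (weight i * fromℕ (f ⊤))              ≈⟨ average (fromℕ (f ⊤)) ⟩
      fromℕ (f ⊤)                                         ∎)
    where
    open Conv conv

    nonNeg : ∀ v → 0# ≤ x v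
    nonNeg v = ≤-trans
      (sum-nonNeg λ i → *-nonNeg (weight-nonNeg i) (proj₁ (proj₁ (P⊆base (point∈P i))) v))
      (≤-reflexive (sym (combination v)))

    total-x : ∀ A → total K x A ≈ ∑[ i < size ] (weight i * total K (point i) A)
    total-x A = trans (total-cong combination A)
      (trans (total-sum (λ i v → weight i * point i v) A)
        (sum-cong-≋ λ i → total-* (weight i) (point i) A))

    average : ∀ a → ∑[ i < size ] (weight i * a) ≈ a
    average a = trans (sym (*-distribʳ-sum a weight)) (trans (*-congʳ weight-sum) (*-identityˡ a))

  basePolytope-resp : {f g : Subset n → ℕ} → (∀ A → f A ≡ g A) → {x : Point K n} →
    basePolytope K f x → basePolytope K g x
  basePolytope-resp f≗g ((0≤x , x≤) , x≈) =
    (0≤x , λ A → ≤-trans (x≤ A) (≤-reflexive (×-congˡ (f≗g A)))) , trans x≈ (×-congˡ (f≗g ⊤))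

  -- The two inclusions for the neighbotope.

  module _ (G : SimpleGraph n) where

    -- A branching picks one vertex from each closed neighbourhood by its locality, and the added
    -- `𝟙` cancels the -1 of the reduced in-degrees; what is left is a `ChoiceSum`.
    translated⊆base : ∀ {x} → translate K (𝟙 K) (neighbotope K G) x →
      basePolytope K (nbFunction G) x
    translated⊆base (y , y∈Γ , x≈y+1) =
      basePolytope-resp {f = coverage (closedNb G)} (λ A → ≡.sym (nbFunction≡coverage G A))
        (Conv⊆base {f = coverage (closedNb G)} (choiceSum⊆base (closedNb G))
          (Conv-+ shift y∈Γ (Conv-point {P = _≡ 𝟙 K} ≡.refl λ _ → refl) x≈y+1))
      where
      shift : {p q : Point K n} → ∃[ β ] (IsBranching G β × (∀ v → p v ≈ reducedInDegree K β v)) →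
        q ≡ 𝟙 K → ChoiceSum (closedNb G) (λ v → p v + q v)
      shift {p} (β , branching , p≈) ≡.refl =
        β , (λ u → ∈-closedNb⁺ G (IsBranching.local branching u)) , λ v →
          trans (+-congʳ (p≈ v)) (trans (x-y+y≈x (fromℕ (inDegree β v)) 1#) (fromℕ-inDegree β v))

    base⊆translated : ∀ {x} → basePolytope K (nbFunction G) x →
      translate K (𝟙 K) (neighbotope K G) x
    base⊆translated {x} x∈base = (λ v → x v - 1#)
      , Conv-+ shift (polymatroid⊆Conv (closedNb G) (proj₁ x∈base′) n≤x)
                     (Conv-point {P = _≡ (λ _ → - 1#)} ≡.refl λ _ → refl) (λ _ → refl)
      , λ v → sym (x-y+y≈x (x v) 1#)
      where
      x∈base′ : basePolytope K (coverage (closedNb G)) x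
      x∈base′ = basePolytope-resp (nbFunction≡coverage G) x∈base

      -- The summand |⊤| of `nbFunction G ⊤` already equals n.
      n≤x : fromℕ n ≤ total K x ⊤
      n≤x = begin
        fromℕ n                   ≡⟨ ≡.cong fromℕ (∣⊤∣≡n n) ⟨
        fromℕ ∣ ⊤ {n} ∣           ≤⟨ fromℕ-mono (ℕ.m≤m+n ∣ ⊤ {n} ∣ _) ⟩
        fromℕ (nbFunction G ⊤)    ≈⟨ proj₂ x∈base ⟨
        total K x ⊤               ∎

      shift : {p q : Point K n} → ChoiceSum (closedNb G) p → q ≡ (λ _ → - 1#) →
        ∃[ β ] (IsBranching G β × (∀ v → p v + q v ≈ reducedInDegree K β v))
      shift {p} (β , β∈N , p≈) ≡.refl
        -- The choice function may have cycles; its unwinding is a branching and differs from it by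
        -- the permutation `π` of the arguments, under which the sum of unit vectors is invariant.
        with β′ , π , branching , β′≗β∘π ← unwinding G β (λ u → ∈-closedNb⁻ G (β∈N u)) =
        β′ , branching , λ v → +-congʳ (begin-equality
          p v                                 ≈⟨ p≈ v ⟩
          ∑[ u < n ] unit (β u) v             ≈⟨ sum-permute (λ u → unit (β u) v) π ⟩
          ∑[ u < n ] unit (β (π ⟨$⟩ʳ u)) v    ≡⟨ sum-cong-≗ (λ u → ≡.cong (λ w → unit w v) (β′≗β∘π u)) ⟨
          ∑[ u < n ] unit (β′ u) v            ≈⟨ fromℕ-inDegree β′ v ⟨
          fromℕ (inDegree β′ v)               ∎)

proposition7p3 : ∀ {c ℓ₁ ℓ₂} (K : OrderedField c ℓ₁ ℓ₂) (n : ℕ) (G : SimpleGraph n) →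
    IsPolymatroid (nbFunction G) ×
    (translate K (𝟙 K) (neighbotope K G) ≐ basePolytope K (nbFunction G))
proposition7p3 K n G =
  IsPolymatroid-resp (λ A → ≡.sym (nbFunction≡coverage G A)) (coverage-isPolymatroid (closedNb G))
  , translated⊆base K G , base⊆translated K G
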